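{- For every integer $n\ge1$, $$f(n,10,4)=\delta(n,10,3)\qquad\text{and}\qquad f(n,13,4)=\delta(n,13,3).$$
   Context: A balanced $r$-partite graph with parts of size $n$ is a simple graph whose vertex set is partitioned into $r$ independent sets, each of size $n$. $f(n,r,t+1)$ denotes the largest possible minimum degree of a balanced $r$-partite graph with parts of size $n$ containing no copy of the complete graph $K_{t+1}$. $\delta(n,r,t)$ denotes the largest possible minimum degree of a balanced $r$-partite graph with parts of size $n$ and chromatic number at most $t$. -}

module Defs where

open import Data.Bool using (Bool; true; false; not)
open import Data.Fin using (Fin)
open import Data.Fin.Properties using (_≟_)
open import Data.Fin.Subset using (Subset; ∣_∣)
open import Data.Nat using (ℕ; _≤_)
open import Data.Product using (∃-syntax; Σ-syntax; _×_)
open import Data.Vec using (tabulate)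
open import Function.Definitions using (Injective)
open import Relation.Binary.PropositionalEquality using (_≡_; _≢_; refl; sym)
open import Relation.Nullary using (¬_; yes; no; does; contradiction)

IsGreatest : (ℕ → Set) → ℕ → Set
IsGreatest P m = P m × (∀ k → P k → k ≤ m)

IsLeast : (ℕ → Set) → ℕ → Set
IsLeast P m = P m × (∀ k → P k → m ≤ k)

-- Adjacency is Boolean-valued, so that it is decidable and degrees are numbers.
record SimpleGraph (N : ℕ) : Set where
  field
    adj    : Fin N → Fin N → Bool
    irrefl : ∀ v → adj v v ≡ false
    symm   : ∀ u v → adj u v ≡ adj v u

  Adj : Fin N → Fin N → Set
  Adj u v = adj u v ≡ true

  neighbours : Fin N → Subset N
  neighbours v = tabulate (adj v)

  degree : Fin N → ℕ
  degree v = ∣ neighbours v ∣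

open SimpleGraph public using (Adj; degree)

IsMinDegree : ∀ {N} → SimpleGraph N → ℕ → Set
IsMinDegree G = IsLeast (λ d → ∃[ v ] degree G v ≡ d)

complete : ∀ k → SimpleGraph k
complete k = record
  { adj    = λ i j → not (does (i ≟ j))
  ; irrefl = irr
  ; symm   = sy
  }
  where
  irr : (i : Fin k) → not (does (i ≟ i)) ≡ false
  irr i with i ≟ i
  ... | yes _   = refl
  ... | no  i≢i = contradiction refl i≢i

  sy : (i j : Fin k) → not (does (i ≟ j)) ≡ not (does (j ≟ i))
  sy i j with i ≟ j | j ≟ i
  ... | yes _   | yes _   = refl
  ... | no  _   | no  _   = refl
  ... | yes i≡j | no  j≢i = contradiction (sym i≡j) j≢i
  ... | no  i≢j | yes j≡i = contradiction (sym j≡i) i≢j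

-- A copy of H in G is a not necessarily induced subgraph of G isomorphic to H.
ContainsCopy : ∀ {M N} → SimpleGraph M → SimpleGraph N → Set
ContainsCopy {M} {N} H G =
  Σ[ φ ∈ (Fin M → Fin N) ]
    Injective _≡_ _≡_ φ × (∀ i j → Adj H i j → Adj G (φ i) (φ j))

Colourable : ∀ {N} → SimpleGraph N → ℕ → Set
Colourable {N} G k =
  Σ[ c ∈ (Fin N → Fin k) ] (∀ u v → Adj G u v → c u ≢ c v)

IsChromaticNumber : ∀ {N} → SimpleGraph N → ℕ → Set
IsChromaticNumber G = IsLeast (Colourable G)

ChromaticNumberAtMost : ∀ {N} → SimpleGraph N → ℕ → Set
ChromaticNumberAtMost G t = ∃[ χ ] (IsChromaticNumber G χ × χ ≤ t)

-- The number of vertices N is not prescribed; the part sizes force N = r * n.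
record BalancedPartite (n r : ℕ) : Set where
  field
    N           : ℕ
    graph       : SimpleGraph N
    part        : Fin N → Fin r
    part-size   : ∀ i → ∣ tabulate (λ v → does (part v ≟ i)) ∣ ≡ n
    independent : ∀ u v → part u ≡ part v → ¬ Adj graph u v

open BalancedPartite public using (graph)

-- Extremal numbers are given by their graphs as relations, since the maximum
-- need not exist for degenerate parameters: Is-f n r k m says f(n,r,k) = m.
-- The last index k is the order of the forbidden complete graph.
Is-f : (n r k m : ℕ) → Set
Is-f n r k = IsGreatest λ d →
  Σ[ G ∈ BalancedPartite n r ]
    (¬ ContainsCopy (complete k) (graph G) × IsMinDegree (graph G) d)

Is-δ : (n r t m : ℕ) → Set
Is-δ n r t = IsGreatest λ d →
  Σ[ G ∈ BalancedPartite n r ]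
    (ChromaticNumberAtMost (graph G) t × IsMinDegree (graph G) d)

{-# OPTIONS --safe #-}
-- A K₄-free graph on N vertices whose minimum degree d satisfies 8d > 5N is
-- 3-colourable (Andrásfai–Erdős–Sós), so it suffices to find a 3-colourable balanced
-- graph of minimum degree at least ⌊5rn/8⌋.  For r = 3k + 4 with k = 2, 3 and
-- p = ⌊n/4⌋, ⌊n/8⌋ respectively, give each colour k whole parts, and let four more
-- parts have p vertices of colour 0 and the rest of colour 1 (two parts) or
-- 2 (two parts); join all differently coloured vertices of different parts.
--
-- For the theorem of Andrásfai, Erdős and Sós, saturate the graph.  If x ≁ y ≁ z but
-- x ∼ z, saturation gives edges pq in N(x) ∩ N(y) and st in N(y) ∩ N(z), a Moser
-- spindle.  A vertex adjacent to five of its seven vertices is the hub of a 5-wheel,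
-- which forces 8d ≤ 5N, and otherwise 7d ≤ 4N.  Hence non-adjacency is transitive,
-- and the saturated graph is complete multipartite with at most three classes.
module Submission where

import Algebra.Properties.CommutativeMonoid.Sum
open import Data.Bool using (Bool; true; false; not; _∧_; _∨_)
import Data.Bool.Properties as Bool
open import Data.Empty using (⊥)
open import Data.Fin using (Fin; zero; suc; splitAt; remQuot; combine; finToFun; funToFin; inject≤; fromℕ<)
open import Data.Fin.Patterns using (0F; 1F; 2F; 3F)
open import Data.Fin.Properties
  using (_≟_; any?; all?; pigeonhole; <⇒≢; inject≤-injective; finToFun-funToFin)
open import Data.Fin.Subset using (∣_∣)
open import Data.Fin.Subset.Properties using (∣p∣≤n)
open import Data.List using (List; []; _∷_; allFin; cartesianProduct)
open import Data.List.Membership.Propositional.Properties using (∈-allFin; ∈-cartesianProduct⁺)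
open import Data.List.Relation.Unary.All as All using (All; []; _∷_)
open import Data.Nat hiding (_≟_)
open import Data.Nat.DivMod using (_%_; _/_; m≡m%n+[m/n]*n; m%n<n)
open import Data.Nat.Properties hiding (<⇒≢; _≟_)
open import Data.Nat.Properties using () renaming (_≟_ to _≟ℕ_)
open import Data.Nat.Tactic.RingSolver using (solve-∀)
open import Data.Product using (Σ-syntax; ∃; ∃-syntax; _×_; _,_; proj₁; proj₂; map₁; uncurry)
open import Data.Sum as Sum using (_⊎_; inj₁; inj₂; [_,_]′)
open import Data.Vec using (tabulate; lookup; []; _∷_)
open import Data.Vec.Properties using (tabulate-cong)
open import Function using (_∘_; const)
open import Relation.Binary.PropositionalEquality
open import Relation.Nullary using (¬_; Dec; yes; no; does; contradiction)
open import Relation.Nullary.Decidable using (map′; from-yes; dec-true; dec-false; _×-dec_; _→-dec_; ¬?)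
open import Relation.Unary using (Decidable)
open import Defs

open Algebra.Properties.CommutativeMonoid.Sum +-0-commutativeMonoid
  using (sum; ∑-distrib-+; ∑-comm; sum-cong-≗)

private
  variable
    k m n r N : ℕ

-- Sums and counting

𝟙 : Bool → ℕ
𝟙 true  = 1
𝟙 false = 0

∣tabulate∣≡sum : (b : Fin n → Bool) → ∣ tabulate b ∣ ≡ sum (𝟙 ∘ b)
∣tabulate∣≡sum {zero}  b = refl
∣tabulate∣≡sum {suc n} b with b zero
... | true  = cong suc (∣tabulate∣≡sum (b ∘ suc))
... | false = ∣tabulate∣≡sum (b ∘ suc)

sum-mono : {f g : Fin n → ℕ} → (∀ i → f i ≤ g i) → sum f ≤ sum g
sum-mono {zero}  f≤g = z≤n
sum-mono {suc n} f≤g = +-mono-≤ (f≤g zero) (sum-mono (f≤g ∘ suc))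

sum-const : ∀ n c → sum {n} (const c) ≡ n * c
sum-const zero    c = refl
sum-const (suc n) c = cong (c +_) (sum-const n c)

sum-*ˡ : ∀ c (f : Fin n → ℕ) → sum (λ i → c * f i) ≡ c * sum f
sum-*ˡ {zero}  c f = sym (*-zeroʳ c)
sum-*ˡ {suc n} c f = trans (cong (c * f zero +_) (sum-*ˡ c (f ∘ suc)))
                           (sym (*-distribˡ-+ c (f zero) _))

sum-splitAt : ∀ m (f : Fin m ⊎ Fin n → ℕ) →
              sum (f ∘ splitAt m) ≡ sum (f ∘ inj₁) + sum (f ∘ inj₂)
sum-splitAt zero    f = refl
sum-splitAt (suc m) f =
  trans (cong (f (inj₁ zero) +_) (sum-splitAt m (f ∘ Sum.map₁ suc)))
        (sym (+-assoc (f (inj₁ zero)) _ _))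

sum-remQuot : ∀ r (f : Fin r × Fin n → ℕ) →
              sum (f ∘ remQuot n) ≡ sum (λ i → sum (λ j → f (i , j)))
sum-remQuot zero    f = refl
sum-remQuot {n} (suc r) f =
  trans (sum-cong-≗ split)
  (trans (sum-splitAt n [ f ∘ (zero ,_) , f ∘ map₁ suc ∘ remQuot {r} n ]′)
         (cong (sum (λ j → f (zero , j)) +_) (sum-remQuot r (f ∘ map₁ suc))))
  where
  split : ∀ i → f (remQuot n i) ≡ [ f ∘ (zero ,_) , f ∘ map₁ suc ∘ remQuot {r} n ]′ (splitAt n i)
  split i with splitAt n i
  ... | inj₁ _ = refl
  ... | inj₂ _ = refl

sum-𝟙≟ˡ : (i : Fin n) → sum (λ j → 𝟙 (does (i ≟ j))) ≡ 1
sum-𝟙≟ˡ {suc n} zero    = cong suc (trans (sum-const n 0) (*-zeroʳ n))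
sum-𝟙≟ˡ {suc n} (suc i) = sum-𝟙≟ˡ i

sum-𝟙≟ʳ : (i : Fin n) → sum (λ j → 𝟙 (does (j ≟ i))) ≡ 1
sum-𝟙≟ʳ {suc n} zero    = cong suc (trans (sum-const n 0) (*-zeroʳ n))
sum-𝟙≟ʳ {suc n} (suc i) = sum-𝟙≟ʳ i

-- Double counting of the pairs `(v , i)` with `part v ≡ i`: each vertex lies in one part, each part
-- has `n` vertices.
parts-cover : (part : Fin N → Fin r) →
              (∀ i → ∣ tabulate (λ v → does (part v ≟ i)) ∣ ≡ n) → N ≡ r * n
parts-cover {N} {r} {n} part size = begin
  N                                            ≡⟨ *-identityʳ N ⟨
  N * 1                                        ≡⟨ sum-const N 1 ⟨
  sum {N} (const 1)                            ≡⟨ sum-cong-≗ (λ v → sum-𝟙≟ˡ (part v)) ⟨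
  sum (λ v → sum (λ i → 𝟙 (does (part v ≟ i)))) ≡⟨ ∑-comm (λ v i → 𝟙 (does (part v ≟ i))) ⟩
  sum (λ i → sum (λ v → 𝟙 (does (part v ≟ i)))) ≡⟨ sum-cong-≗ (λ i → ∣tabulate∣≡sum (λ v → does (part v ≟ i))) ⟨
  sum (λ i → ∣ tabulate (λ v → does (part v ≟ i)) ∣) ≡⟨ sum-cong-≗ size ⟩
  sum {r} (const n)                            ≡⟨ sum-const r n ⟩
  r * n                                        ∎
  where open ≡-Reasoning

degree≡sum : (G : SimpleGraph N) (v : Fin N) → degree G v ≡ sum (𝟙 ∘ SimpleGraph.adj G v)
degree≡sum G v = ∣tabulate∣≡sum (SimpleGraph.adj G v)

degree-mono : (G H : SimpleGraph N) (v : Fin N) →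
              (∀ w → Adj G v w → Adj H v w) → degree G v ≤ degree H v
degree-mono G H v G⊆H rewrite degree≡sum G v | degree≡sum H v = sum-mono (λ w → 𝟙-mono (G⊆H w))
  where
  𝟙-mono : ∀ {a b} → (a ≡ true → b ≡ true) → 𝟙 a ≤ 𝟙 b
  𝟙-mono {false}         _ = z≤n
  𝟙-mono {true}  {true}  _ = ≤-refl
  𝟙-mono {true}  {false} i with () ← i refl

adj-sym : (G : SimpleGraph N) {u v : Fin N} → Adj G u v → Adj G v u
adj-sym G {u} {v} uv = trans (SimpleGraph.symm G v u) uv

adj⇒≢ : (G : SimpleGraph N) {u v : Fin N} → Adj G u v → u ≢ v
adj⇒≢ G {u} uu refl with () ← trans (sym uu) (SimpleGraph.irrefl G u)

adj? : (G : SimpleGraph N) (u v : Fin N) → Dec (Adj G u v)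
adj? G u v = SimpleGraph.adj G u v Bool.≟ true

-- Counts the adjacencies between the listed vertices `w` and all vertices from both sides. The list
-- may repeat a vertex, so repetition serves as an integer weight and distinctness never has to be
-- checked.
double-count : (G : SimpleGraph N) {d c : ℕ} → (∀ v → d ≤ degree G v) →
               (w : Fin k → Fin N) →
               (∀ v → sum (λ i → 𝟙 (SimpleGraph.adj G (w i) v)) ≤ c) → k * d ≤ N * c
double-count {N} {k} G {d} {c} d≤ w ≤c = begin
  k * d                                                     ≡⟨ sum-const k d ⟨
  sum {k} (const d)                                         ≤⟨ sum-mono (λ i → d≤ (w i)) ⟩
  sum (λ i → degree G (w i))                                ≡⟨ sum-cong-≗ (λ i → degree≡sum G (w i)) ⟩
  sum (λ i → sum (λ v → 𝟙 (SimpleGraph.adj G (w i) v)))     ≡⟨ ∑-comm (λ i v → 𝟙 (SimpleGraph.adj G (w i) v)) ⟩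
  sum (λ v → sum (λ i → 𝟙 (SimpleGraph.adj G (w i) v)))     ≤⟨ sum-mono ≤c ⟩
  sum {N} (const c)                                         ≡⟨ sum-const N c ⟩
  N * c                                                     ∎
  where open ≤-Reasoning

-- The theorem of Andrásfai, Erdős and Sós for K₄

K₄-free : SimpleGraph N → Set
K₄-free G = ∀ a b c d → Adj G a b → Adj G a c → Adj G a d → Adj G b c → Adj G b d → Adj G c d → ⊥

-- The trace of K₄-freeness at one vertex: the Booleans record its adjacency to the corners of a
-- triangle, which cannot all hold. Stated on Booleans so that the weight bounds can be checked by
-- enumeration.
Incomplete : Bool → Bool → Bool → Set
Incomplete a b c = a ≡ true → b ≡ true → c ≡ true → ⊥

incomplete? : ∀ a b c → Dec (Incomplete a b c)
incomplete? a b c = (a Bool.≟ true) →-dec ((b Bool.≟ true) →-dec ((c Bool.≟ true) →-dec no λ ()))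

allBool? : {P : Bool → Set} → Decidable P → Dec (∀ b → P b)
allBool? P? = map′ (λ { (t , f) → λ { true → t ; false → f } }) (λ h → h true , h false)
                   (P? true ×-dec P? false)

-- The hub is counted three times: this weighting gives the ratio 5/8.
wheelWeight : (h a b c d e : Bool) → ℕ
wheelWeight h a b c d e = sum (𝟙 ∘ lookup (h ∷ h ∷ h ∷ a ∷ b ∷ c ∷ d ∷ e ∷ []))

-- A vertex adjacent to the hub sees no two consecutive rim vertices, hence at most two of them: 3 +
-- 2. Any other vertex sees at most the five rim vertices.
wheel-weight : ∀ h a b c d e →
  Incomplete h a b → Incomplete h b c → Incomplete h c d → Incomplete h d e → Incomplete h e a →
  wheelWeight h a b c d e ≤ 5
wheel-weight = from-yes
  (allBool? λ h → allBool? λ a → allBool? λ b → allBool? λ c → allBool? λ d → allBool? λ e →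
   incomplete? h a b →-dec (incomplete? h b c →-dec (incomplete? h c d →-dec
   (incomplete? h d e →-dec (incomplete? h e a →-dec (wheelWeight h a b c d e ≤? 5))))))

spindleWeight : (x y z p q s t : Bool) → ℕ
spindleWeight x y z p q s t = sum (𝟙 ∘ lookup (x ∷ y ∷ z ∷ p ∷ q ∷ s ∷ t ∷ []))

-- If `p` and `q` both hold, then `x` and `y` fail and at most two of `z`, `s`, `t` remain; likewise
-- for `s` and `t`. Otherwise each pair contributes at most one: without all of `x`, `y`, `z` this
-- gives 2 + 1 + 1, and with all three the last hypothesis leaves 3 + 1.
spindle-weight : ∀ x y z p q s t →
  Incomplete x p q → Incomplete y p q → Incomplete y s t → Incomplete z s t →
  Incomplete (x ∧ y ∧ z) (p ∨ q) (s ∨ t) →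
  spindleWeight x y z p q s t ≤ 4
spindle-weight = from-yes
  (allBool? λ x → allBool? λ y → allBool? λ z → allBool? λ p → allBool? λ q → allBool? λ s → allBool? λ t →
   incomplete? x p q →-dec (incomplete? y p q →-dec (incomplete? y s t →-dec
   (incomplete? z s t →-dec (incomplete? (x ∧ y ∧ z) (p ∨ q) (s ∨ t) →-dec (spindleWeight x y z p q s t ≤? 4))))))

∧-true : ∀ {a b} → a ∧ b ≡ true → a ≡ true × b ≡ true
∧-true {true} {true} _ = refl , refl

∨-true : ∀ {a b} → a ∨ b ≡ true → a ≡ true ⊎ b ≡ true
∨-true {true}  _ = inj₁ refl
∨-true {false} e = inj₂ e

-- The obstruction to adding the edge `uv`: together with `p` and `q` it would complete a K₄.
JoinedByEdge : SimpleGraph N → Fin N → Fin N → Set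
JoinedByEdge G u v =
  ∃[ p ] ∃[ q ] Adj G u p × Adj G u q × Adj G v p × Adj G v q × Adj G p q

joinedByEdge? : (G : SimpleGraph N) (u v : Fin N) → Dec (JoinedByEdge G u v)
joinedByEdge? G u v = any? λ p → any? λ q →
  adj? G u p ×-dec adj? G u q ×-dec adj? G v p ×-dec adj? G v q ×-dec adj? G p q

module _ (G : SimpleGraph N) (free : K₄-free G) {d : ℕ} (d≤ : ∀ v → d ≤ degree G v)
         (dense : 5 * N < 8 * d) where

  private
    _∼_ = Adj G
    sy : ∀ {u v} → u ∼ v → v ∼ u
    sy = adj-sym G

  no-wheel : ∀ h a b c d e → h ∼ a → h ∼ b → h ∼ c → h ∼ d → h ∼ e →
             a ∼ b → b ∼ c → c ∼ d → d ∼ e → e ∼ a → ⊥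
  no-wheel h a b c d e ha hb hc hd he ab bc cd de ea =
    <⇒≱ dense (≤-trans (double-count G d≤ w bound) (≤-reflexive (*-comm N 5)))
    where
    w : Fin 8 → Fin N
    w = lookup (h ∷ h ∷ h ∷ a ∷ b ∷ c ∷ d ∷ e ∷ [])
    tri : ∀ v {x y} → h ∼ x → h ∼ y → x ∼ y →
          Incomplete (SimpleGraph.adj G h v) (SimpleGraph.adj G x v) (SimpleGraph.adj G y v)
    tri v hx hy xy hv xv yv = free h _ _ v hx hy hv xy xv yv
    bound : ∀ v → sum (λ i → 𝟙 (SimpleGraph.adj G (w i) v)) ≤ 5
    bound v = wheel-weight _ _ _ _ _ _
      (tri v ha hb ab) (tri v hb hc bc) (tri v hc hd cd) (tri v hd he de) (tri v he ha ea)

  no-spindle : ∀ {x y z} → x ∼ z → JoinedByEdge G x y → JoinedByEdge G y z → ⊥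
  no-spindle {x} {y} {z} xz (p , q , xp , xq , yp , yq , pq) (s , t , ys , yt , zs , zt , st) =
    <-irrefl refl (begin-strict
      8 * (7 * d)   ≤⟨ *-monoʳ-≤ 8 (double-count G d≤ w bound) ⟩
      8 * (N * 4)   ≡⟨ solve₁ N ⟩
      -- This is 4/7 < 5/8 with denominators cleared.
      32 * N        ≤⟨ *-monoˡ-≤ N (m≤m+n 32 3) ⟩
      35 * N        ≡⟨ *-assoc 7 5 N ⟩
      7 * (5 * N)   <⟨ *-monoʳ-< 7 dense ⟩
      7 * (8 * d)   ≡⟨ solve₂ d ⟩
      8 * (7 * d)   ∎)
    where
    open ≤-Reasoning
    solve₁ : ∀ a → 8 * (a * 4) ≡ 32 * a
    solve₁ = solve-∀
    solve₂ : ∀ a → 7 * (8 * a) ≡ 8 * (7 * a)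
    solve₂ = solve-∀
    w : Fin 7 → Fin N
    w = lookup (x ∷ y ∷ z ∷ p ∷ q ∷ s ∷ t ∷ [])
    tri : ∀ v {a b c} → a ∼ b → a ∼ c → b ∼ c →
          Incomplete (SimpleGraph.adj G a v) (SimpleGraph.adj G b v) (SimpleGraph.adj G c v)
    tri v ab ac bc av bv cv = free _ _ _ v ab ac av bc bv cv
    -- The closed walk `x p y s z`, completed by the edge `xz`, is the rim of a wheel with hub `v`.
    cycle : ∀ v {p s} → x ∼ p → y ∼ p → y ∼ s → z ∼ s → x ∼ v → y ∼ v → z ∼ v → p ∼ v → s ∼ v → ⊥
    cycle v {p} {s} xp yp ys zs xv yv zv pv sv =
      no-wheel v x p y s z (sy xv) (sy pv) (sy yv) (sy sv) (sy zv) xp (sy yp) ys (sy zs) (sy xz)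
    hub : ∀ v → Incomplete (SimpleGraph.adj G x v ∧ SimpleGraph.adj G y v ∧ SimpleGraph.adj G z v)
                           (SimpleGraph.adj G p v ∨ SimpleGraph.adj G q v)
                           (SimpleGraph.adj G s v ∨ SimpleGraph.adj G t v)
    hub v xyz pq st with xv , yz ← ∧-true xyz with yv , zv ← ∧-true yz with ∨-true pq | ∨-true st
    ... | inj₁ pv | inj₁ sv = cycle v xp yp ys zs xv yv zv pv sv
    ... | inj₁ pv | inj₂ tv = cycle v xp yp yt zt xv yv zv pv tv
    ... | inj₂ qv | inj₁ sv = cycle v xq yq ys zs xv yv zv qv sv
    ... | inj₂ qv | inj₂ tv = cycle v xq yq yt zt xv yv zv qv tv
    bound : ∀ v → sum (λ i → 𝟙 (SimpleGraph.adj G (w i) v)) ≤ 4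
    bound v = spindle-weight _ _ _ _ _ _ _
      (tri v xp xq pq) (tri v yp yq pq) (tri v ys yt st) (tri v zs zt st) (hub v)

  saturated⇒colourable :
    (∀ u v → Adj G u v ⊎ u ≡ v ⊎ JoinedByEdge G u v) → Colourable G 3
  saturated⇒colourable sat = colouring (any? λ a → any? λ b → adj? G a b)
    where
    ≁-trans : ∀ {x y z} → ¬ x ∼ y → ¬ y ∼ z → ¬ x ∼ z
    ≁-trans {x} {y} {z} x≁y y≁z xz with sat x y | sat y z
    ... | inj₁ xy          | _                = x≁y xy
    ... | inj₂ (inj₁ refl) | _                = y≁z xz
    ... | inj₂ (inj₂ _)    | inj₁ yz          = y≁z yz
    ... | inj₂ (inj₂ _)    | inj₂ (inj₁ refl) = x≁y xz
    ... | inj₂ (inj₂ xy)   | inj₂ (inj₂ yz)   = no-spindle xz xy yz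

    colouring : Dec (∃[ a ] ∃[ b ] a ∼ b) → Colourable G 3
    colouring (no edgeless)     = const zero , λ u v uv _ → edgeless (u , v , uv)
    colouring (yes (a , b , ab)) = colour , proper
      where
      -- Colours 0 and 1 are the non-neighbours of `a` and the remaining non-neighbours of `b`,
      -- independent because non-adjacency is transitive. Colour 2 is the common neighbourhood of
      -- the edge `ab`, independent because an edge in it would give a K₄.
      colour : Fin N → Fin 3
      colour v with adj? G v a | adj? G v b
      ... | no  _ | _     = 0F
      ... | yes _ | no  _ = 1F
      ... | yes _ | yes _ = 2F

      proper : ∀ u v → u ∼ v → colour u ≢ colour v
      proper u v uv eq with adj? G u a | adj? G u b | adj? G v a | adj? G v b
      ... | no u≁a | _      | no v≁a | _      = ≁-trans u≁a (v≁a ∘ sy) uv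
      ... | yes _  | no u≁b | yes _  | no v≁b = ≁-trans u≁b (v≁b ∘ sy) uv
      ... | yes ua | yes ub | yes va | yes vb = free a b u v ab (sy ua) (sy va) (sy ub) (sy vb) uv
      proper u v uv () | no _  | _     | yes _ | no _
      proper u v uv () | no _  | _     | yes _ | yes _
      proper u v uv () | yes _ | no _  | no _  | _
      proper u v uv () | yes _ | yes _ | no _  | _
      proper u v uv () | yes _ | no _  | yes _ | yes _
      proper u v uv () | yes _ | yes _ | yes _ | no _

-- Saturation of K₄-free graphs

module AddEdge (G : SimpleGraph N) {u v : Fin N} (u≢v : u ≢ v) where
  private module G = SimpleGraph G

  new : Fin N → Fin N → Bool
  new a b = (does (a ≟ u) ∧ does (b ≟ v)) ∨ (does (a ≟ v) ∧ does (b ≟ u))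

  private
    new-irrefl : ∀ a → new a a ≡ false
    new-irrefl a with a ≟ u | a ≟ v
    ... | yes refl | yes refl = contradiction refl u≢v
    ... | yes _    | no  _    = refl
    ... | no  _    | yes _    = refl
    ... | no  _    | no  _    = refl

    new-sym : ∀ a b → new a b ≡ new b a
    new-sym a b = trans (Bool.∨-comm (does (a ≟ u) ∧ does (b ≟ v)) _)
                        (cong₂ _∨_ (Bool.∧-comm (does (a ≟ v)) _) (Bool.∧-comm (does (a ≟ u)) _))

  addEdge : SimpleGraph N
  addEdge = record
    { adj    = λ a b → G.adj a b ∨ new a b
    ; irrefl = λ a → cong₂ _∨_ (G.irrefl a) (new-irrefl a)
    ; symm   = λ a b → cong₂ _∨_ (G.symm a b) (new-sym a b)
    }

  old⇒addEdge : ∀ {a b} → Adj G a b → Adj addEdge a b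
  old⇒addEdge {a} {b} ab = cong (_∨ new a b) ab

  addEdge-uv : Adj addEdge u v
  addEdge-uv rewrite dec-true (u ≟ u) refl | dec-true (v ≟ v) refl = Bool.∨-zeroʳ (G.adj u v)

  private
    new⇒ends : ∀ {a b} → new a b ≡ true → (a ≡ u × b ≡ v) ⊎ (a ≡ v × b ≡ u)
    new⇒ends {a} {b} e with a ≟ u | b ≟ v | a ≟ v | b ≟ u
    ... | yes p | yes q | _     | _     = inj₁ (p , q)
    ... | _     | _     | yes p | yes q = inj₂ (p , q)
    new⇒ends () | yes _ | no _ | yes _ | no _
    new⇒ends () | yes _ | no _ | no _  | _
    new⇒ends () | no _  | _    | yes _ | no _
    new⇒ends () | no _  | _    | no _  | _

    avoids⇒old : ∀ {a b} → a ≢ u → a ≢ v → Adj addEdge a b → Adj G a b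
    avoids⇒old {a} {b} a≢u a≢v ab with ∨-true {G.adj a b} ab
    ... | inj₁ old = old
    ... | inj₂ new with new⇒ends {a} {b} new
    ...   | inj₁ (a≡u , _) = contradiction a≡u a≢u
    ...   | inj₂ (a≡v , _) = contradiction a≡v a≢v

  private
    flip : ∀ {a b} → Adj addEdge a b → Adj addEdge b a
    flip = adj-sym addEdge

    -- Being adjacent to both `u` and `v`, the vertices `c` and `d` differ from both, so no edge at
    -- `c` or `d` is the new one.
    ends-joined : ∀ {c d} → Adj addEdge u c → Adj addEdge u d →
                  Adj addEdge v c → Adj addEdge v d → Adj addEdge c d → JoinedByEdge G u v
    ends-joined {c} {d} uc ud vc vd cd =
      c , d , adj-sym G (old uc vc (flip uc)) , adj-sym G (old ud vd (flip ud))
            , adj-sym G (old uc vc (flip vc)) , adj-sym G (old ud vd (flip vd)) , old uc vc cd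
      where
      old : ∀ {a b} → Adj addEdge u a → Adj addEdge v a → Adj addEdge a b → Adj G a b
      old ua va = avoids⇒old (adj⇒≢ addEdge (flip ua)) (adj⇒≢ addEdge (flip va))

    new-in-no-K₄ : ¬ JoinedByEdge G u v → ∀ {a b c d} → new a b ≡ true →
                   Adj addEdge a c → Adj addEdge a d → Adj addEdge b c → Adj addEdge b d →
                   Adj addEdge c d → ⊥
    new-in-no-K₄ unjoined {a} {b} n ac ad bc bd cd with new⇒ends {a} {b} n
    ... | inj₁ (refl , refl) = unjoined (ends-joined ac ad bc bd cd)
    ... | inj₂ (refl , refl) = unjoined (ends-joined bc bd ac ad cd)

  -- Each of the six edges of a supposed K₄ is tried as the new one, with the vertices permuted to
  -- bring that edge to the front; if all six are old, the K₄ lies in `G`.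
  addEdge-K₄-free : K₄-free G → ¬ JoinedByEdge G u v → K₄-free addEdge
  addEdge-K₄-free free unjoined a b c d ab ac ad bc bd cd
    with split ab | split ac | split ad | split bc | split bd | split cd
    where
    split : ∀ {a b} → Adj addEdge a b → Adj G a b ⊎ new a b ≡ true
    split {a} {b} = ∨-true {G.adj a b}
  ... | inj₂ n  | _       | _       | _       | _       | _       =
    new-in-no-K₄ unjoined n ac ad bc bd cd
  ... | _       | inj₂ n  | _       | _       | _       | _       =
    new-in-no-K₄ unjoined n ab ad (flip bc) cd bd
  ... | _       | _       | inj₂ n  | _       | _       | _       =
    new-in-no-K₄ unjoined n ab ac (flip bd) (flip cd) bc
  ... | _       | _       | _       | inj₂ n  | _       | _       =
    new-in-no-K₄ unjoined n (flip ab) bd (flip ac) cd ad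
  ... | _       | _       | _       | _       | inj₂ n  | _       =
    new-in-no-K₄ unjoined n (flip ab) bc (flip ad) (flip cd) ac
  ... | _       | _       | _       | _       | _       | inj₂ n  =
    new-in-no-K₄ unjoined n (flip ac) (flip bc) (flip ad) (flip bd) ab
  ... | inj₁ ab | inj₁ ac | inj₁ ad | inj₁ bc | inj₁ bd | inj₁ cd =
    free a b c d ab ac ad bc bd cd

infix 4 _⊆_
_⊆_ : SimpleGraph N → SimpleGraph N → Set
G ⊆ H = ∀ {u v} → Adj G u v → Adj H u v

joinedByEdge-mono : {G H : SimpleGraph N} → G ⊆ H → ∀ {u v} → JoinedByEdge G u v → JoinedByEdge H u v
joinedByEdge-mono G⊆H (p , q , up , uq , vp , vq , pq) =
  p , q , G⊆H up , G⊆H uq , G⊆H vp , G⊆H vq , G⊆H pq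

-- One pass over the pairs suffices, since adjacency, equality and `JoinedByEdge` all persist when
-- further edges are added.
saturate : (G : SimpleGraph N) → K₄-free G → (L : List (Fin N × Fin N)) →
  Σ[ H ∈ SimpleGraph N ] G ⊆ H × K₄-free H ×
    All (uncurry λ u v → Adj H u v ⊎ u ≡ v ⊎ JoinedByEdge H u v) L
saturate G free [] = G , (λ uv → uv) , free , []
saturate G free ((u , v) ∷ L) with u ≟ v | joinedByEdge? G u v
... | yes u≡v | _ =
  let H , G⊆H , freeH , sat = saturate G free L
  in  H , G⊆H , freeH , inj₂ (inj₁ u≡v) ∷ sat
... | no  _   | yes joined =
  let H , G⊆H , freeH , sat = saturate G free L
  in  H , G⊆H , freeH , inj₂ (inj₂ (joinedByEdge-mono {G = G} {H} G⊆H joined)) ∷ sat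
-- If `u` and `v` are already adjacent, adding the edge changes no adjacency.
... | no  u≢v | no  unjoined =
  let open AddEdge G u≢v
      H , G⁺⊆H , freeH , sat = saturate addEdge (addEdge-K₄-free free unjoined) L
  in  H , (λ uv → G⁺⊆H (old⇒addEdge uv)) , freeH , inj₁ (G⁺⊆H addEdge-uv) ∷ sat

-- Saturation only raises degrees, and a proper colouring of the saturated graph is proper on `G`.
andrásfai-erdős-sós : (G : SimpleGraph N) → K₄-free G → ∀ {d} → (∀ v → d ≤ degree G v) →
                      5 * N < 8 * d → Colourable G 3
andrásfai-erdős-sós {N} G free d≤ dense
  with H , G⊆H , freeH , sat ← saturate G free (cartesianProduct (allFin N) (allFin N))
  with colour , proper ← saturated⇒colourable H freeH
         (λ v → ≤-trans (d≤ v) (degree-mono G H v (λ w → G⊆H))) dense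
         (λ u v → All.lookup sat (∈-cartesianProduct⁺ (∈-allFin u) (∈-allFin v)))
  = colour , λ u v uv → proper u v (G⊆H uv)

-- Copies of complete graphs

K₄-free⁺ : (G : SimpleGraph N) → ¬ ContainsCopy (complete 4) G → K₄-free G
K₄-free⁺ {N} G no-copy a b c d ab ac ad bc bd cd = no-copy (φ , injective , λ i j ij → φ-adj i j (adj⇒≢ (complete 4) ij))
  where
  φ : Fin 4 → Fin N
  φ = lookup (a ∷ b ∷ c ∷ d ∷ [])

  φ-adj : ∀ i j → i ≢ j → Adj G (φ i) (φ j)
  φ-adj 0F 1F _ = ab
  φ-adj 0F 2F _ = ac
  φ-adj 0F 3F _ = ad
  φ-adj 1F 2F _ = bc
  φ-adj 1F 3F _ = bd
  φ-adj 2F 3F _ = cd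
  φ-adj 1F 0F _ = adj-sym G ab
  φ-adj 2F 0F _ = adj-sym G ac
  φ-adj 3F 0F _ = adj-sym G ad
  φ-adj 2F 1F _ = adj-sym G bc
  φ-adj 3F 1F _ = adj-sym G bd
  φ-adj 3F 2F _ = adj-sym G cd
  φ-adj 0F 0F i≢i = contradiction refl i≢i
  φ-adj 1F 1F i≢i = contradiction refl i≢i
  φ-adj 2F 2F i≢i = contradiction refl i≢i
  φ-adj 3F 3F i≢i = contradiction refl i≢i

  injective : ∀ {i j} → φ i ≡ φ j → i ≡ j
  injective {i} {j} φi≡φj with i ≟ j
  ... | yes i≡j = i≡j
  ... | no  i≢j = contradiction φi≡φj (adj⇒≢ G (φ-adj i j i≢j))

complete-adj : {i j : Fin k} → i ≢ j → Adj (complete k) i j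
complete-adj {i = i} {j} i≢j = cong not (dec-false (i ≟ j) i≢j)

colourable⇒no-copy : (G : SimpleGraph N) → Colourable G k → ¬ ContainsCopy (complete (suc k)) G
colourable⇒no-copy {k = k} G (colour , proper) (φ , _ , φ-adj)
  with i , j , i<j , eq ← pigeonhole (n<1+n k) (colour ∘ φ)
  = proper (φ i) (φ j) (φ-adj i j (complete-adj (<⇒≢ i<j))) eq

-- Extremal numbers by exhaustive search

-- Functions are enumerated by their codes in `Fin (k ^ n)`. Decoding recovers a function only
-- pointwise, hence the requirement that `P` respect `≗`.
anyFunction? : {P : (Fin n → Fin k) → Set} → (∀ {f g} → f ≗ g → P f → P g) →
               Decidable P → Dec (∃ P)
anyFunction? {n} {k} resp P? =
  map′ (λ (x , px) → finToFun x , px)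
       (λ (f , pf) → funToFin f , resp (λ i → sym (finToFun-funToFin f i)) pf)
       (any? (λ (x : Fin (k ^ n)) → P? (finToFun x)))

colourable? : (G : SimpleGraph N) → Decidable (Colourable G)
colourable? G k = anyFunction?
  (λ f≗g proper u v uv eq → proper u v uv (trans (f≗g u) (trans eq (sym (f≗g v)))))
  (λ c → all? λ u → all? λ v → adj? G u v →-dec ¬? (c u ≟ c v))

least : {P : ℕ → Set} → Decidable P → ∀ k → P k → ∃[ m ] IsLeast P m × m ≤ k
least P? zero    p = 0 , (p , λ _ _ → z≤n) , z≤n
least {P} P? (suc k) p with P? 0
... | yes p₀ = 0 , (p₀ , λ _ _ → z≤n) , z≤n
... | no ¬p₀ with m , (pm , min) , m≤k ← least (P? ∘ suc) k p
  = suc m , (pm , min′) , s≤s m≤k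
  where
  min′ : ∀ j → P j → suc m ≤ j
  min′ zero    p₀ = contradiction p₀ ¬p₀
  min′ (suc j) pj = s≤s (min j pj)

greatest : {P : ℕ → Set} → Decidable P → ∀ b → (∀ d → P d → d ≤ b) → ∀ {t} → P t → ∃ (IsGreatest P)
greatest P? zero    ≤b {zero} pt = 0 , pt , ≤b
greatest P? zero    ≤b {suc _} pt with () ← ≤b _ pt
greatest {P} P? (suc b) ≤b pt with P? (suc b)
... | yes p = suc b , p , ≤b
... | no ¬p = greatest P? b ≤b′ pt
  where
  ≤b′ : ∀ d → P d → d ≤ b
  ≤b′ d pd with m≤n⇒m<n∨m≡n (≤b d pd)
  ... | inj₁ (s≤s d≤b) = d≤b
  ... | inj₂ refl      = contradiction pd ¬p

-- The chromatic number itself must be exhibited, so it is found by search up to `k`.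
colourable⇒chromatic≤ : (G : SimpleGraph N) → Colourable G k → ChromaticNumberAtMost G k
colourable⇒chromatic≤ {k = k} G = least (colourable? G) k

colourable-mono : (G : SimpleGraph N) → k ≤ n → Colourable G k → Colourable G n
colourable-mono G k≤n (c , proper) =
  (λ v → inject≤ (c v) k≤n) , λ u v uv eq → proper u v uv (inject≤-injective k≤n k≤n _ _ eq)

minDegree : (G : SimpleGraph N) → Fin N → ∃ (IsMinDegree G)
minDegree G v with m , isMin , _ ← least (λ d → any? λ v → degree G v ≟ℕ d) (degree G v) (v , refl)
  = m , isMin

-- Every graph properly coloured by `colour` with parts `part` lies in this one.
joinGraph : (Fin N → Fin r) → (Fin N → Fin k) → SimpleGraph N
joinGraph part colour = record
  { adj    = λ u v → SimpleGraph.adj (complete _) (part u) (part v) ∧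
                     SimpleGraph.adj (complete _) (colour u) (colour v)
  ; irrefl = λ v → cong (_∧ _) (SimpleGraph.irrefl (complete _) (part v))
  ; symm   = λ u v → cong₂ _∧_ (SimpleGraph.symm (complete _) (part u) (part v))
                               (SimpleGraph.symm (complete _) (colour u) (colour v))
  }

Balanced : ℕ → (Fin N → Fin r) → Set
Balanced n part = ∀ i → ∣ tabulate (λ v → does (part v ≟ i)) ∣ ≡ n

-- The search ranges over partitions and colourings only, as the join graph has the largest degrees
-- among the graphs that they admit. The minimum degree is bounded below by `d`; equality follows at
-- the greatest `d`.
Attains : (N n r d : ℕ) → Set
Attains N n r d = Σ[ part ∈ (Fin N → Fin r) ] Balanced n part ×
  Σ[ colour ∈ (Fin N → Fin 3) ] (∀ v → d ≤ degree (joinGraph part colour) v)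

attains? : ∀ N n r → Decidable (Attains N n r)
attains? N n r d = anyFunction?
  (λ {f} {g} f≗g (size , colour , d≤) →
      (λ i → trans (cong ∣_∣ (tabulate-cong (λ v → cong (λ j → does (j ≟ i)) (sym (f≗g v))))) (size i))
    , colour , λ v → ≤-trans (d≤ v) (degree-≗ {c = colour} f≗g (λ _ → refl) v))
  (λ part → all? (λ i → _ ≟ℕ n) ×-dec anyFunction?
    (λ f≗g d≤ v → ≤-trans (d≤ v) (degree-≗ {part} (λ _ → refl) f≗g v))
    (λ colour → all? λ v → d ≤? _))
  where
  degree-≗ : {p p′ : Fin N → Fin r} {c c′ : Fin N → Fin 3} → p ≗ p′ → c ≗ c′ → ∀ v →
             degree (joinGraph p c) v ≤ degree (joinGraph p′ c′) v
  degree-≗ {p} {p′} {c} {c′} p≗ c≗ v = degree-mono (joinGraph p c) (joinGraph p′ c′) v λ w e →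
    trans (cong₂ _∧_
             (cong₂ (SimpleGraph.adj (complete r)) (sym (p≗ v)) (sym (p≗ w)))
             (cong₂ (SimpleGraph.adj (complete 3)) (sym (c≗ v)) (sym (c≗ w)))) e

colourable⇒attains : (G : BalancedPartite n r) → Colourable (graph G) 3 →
                     ∀ {d} → IsMinDegree (graph G) d → Attains (r * n) n r d
colourable⇒attains {n} {r} G (colour , proper) {d} (_ , min) =
  subst (λ N → Attains N n r d) (parts-cover part part-size)
    (part , part-size , colour , λ v → ≤-trans (min _ (v , refl))
      (degree-mono (BalancedPartite.graph G) (joinGraph part colour) v λ w vw →
        cong₂ _∧_ (complete-adj (λ eq → independent v w eq vw)) (complete-adj (proper v w vw))))
  where open BalancedPartite G using (part; part-size; independent)

-- From one dense construction to equality of the extremal numbers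

module _ {n r t : ℕ} (v₀ : Fin (r * n)) (attained : Attains (r * n) n r t)
         (beyond : 5 * (r * n) < 8 * suc t) where

  -- The optimum `m` over 3-colourable graphs is at least `t`. By `beyond`, a K₄-free graph of
  -- minimum degree above `m` is dense enough to be 3-colourable, and is then bounded by `m` after
  -- all.
  f≡δ : ∃[ m ] (Is-f n r 4 m × Is-δ n r 3 m)
  f≡δ with m , att@(part , size , colour , m≤) , max ←
             greatest (attains? (r * n) n r) (r * n)
               -- The degree of `v₀` bounds the search; with no vertices every `d` would be
               -- attained.
               (λ d (part , _ , colour , d≤) → ≤-trans (d≤ v₀) (∣p∣≤n (SimpleGraph.neighbours (joinGraph part colour) v₀)))
               attained
    = m , ((G , colourable⇒no-copy (graph G) coloured , isMin) , f-max)
        , ((G , colourable⇒chromatic≤ (graph G) coloured , isMin) , δ-max)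
    where
    G : BalancedPartite n r
    G = record
      { N = r * n ; graph = joinGraph part colour ; part = part ; part-size = size
      ; independent = λ u v eq uv → adj⇒≢ (complete r) (proj₁ (∧-true uv)) eq
      }

    coloured : Colourable (graph G) 3
    coloured = colour , λ u v uv → adj⇒≢ (complete 3) (proj₂ (∧-true {SimpleGraph.adj (complete r) (part u) (part v)} uv))

    colourable-max : (H : BalancedPartite n r) → Colourable (graph H) 3 →
                     ∀ d → IsMinDegree (graph H) d → d ≤ m
    colourable-max H col d isMin = max d (colourable⇒attains H col isMin)

    isMin : IsMinDegree (graph G) m
    -- The true minimum degree is at least `m` by construction and at most `m` by maximality.
    isMin with d , isMin@((v , refl) , _) ← minDegree (graph G) v₀ =
      subst (IsMinDegree (graph G)) (≤-antisym (colourable-max G coloured d isMin) (m≤ v)) isMin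

    δ-max : ∀ d → Σ[ H ∈ BalancedPartite n r ]
              (ChromaticNumberAtMost (graph H) 3 × IsMinDegree (graph H) d) → d ≤ m
    δ-max d (H , (χ , (col , _) , χ≤3) , isMin) =
      colourable-max H (colourable-mono (graph H) χ≤3 col) d isMin

    f-max : ∀ d → Σ[ H ∈ BalancedPartite n r ]
              (¬ ContainsCopy (complete 4) (graph H) × IsMinDegree (graph H) d) → d ≤ m
    f-max d (H , no-copy , isMin) with d ≤? m
    ... | yes d≤m = d≤m
    ... | no  d≰m = colourable-max H
      (andrásfai-erdős-sós (graph H) (K₄-free⁺ (graph H) no-copy) (λ v → proj₂ isMin _ (v , refl)) dense) d isMin
      where
      module H = BalancedPartite H
      dense : 5 * H.N < 8 * d
      dense = subst (λ N → 5 * N < 8 * d) (sym (parts-cover H.part H.part-size))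
        (<-≤-trans beyond (*-monoʳ-≤ 8 (≤-<-trans (max t attained) (≰⇒> d≰m))))

-- The extremal colourings

-- Part i has p vertices of colour s i and q of colour t i.
module Mixed {r : ℕ} (s t : Fin r → Fin 3) where

  apart : Fin r → Fin 3 → Fin r → Fin 3 → ℕ
  apart i c i′ c′ = 𝟙 (SimpleGraph.adj (complete r) i i′ ∧ SimpleGraph.adj (complete 3) c c′)

  -- The numbers of blocks of size `p` and of size `q` joined to a vertex of colour `c` in part `i`.
  blocks-s blocks-t : Fin r → Fin 3 → ℕ
  blocks-s i c = sum (λ i′ → apart i c i′ (s i′))
  blocks-t i c = sum (λ i′ → apart i c i′ (t i′))

  module _ (p q : ℕ) where

    part : Fin (r * (p + q)) → Fin r
    part v = proj₁ (remQuot (p + q) v)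

    cell : Fin r → Fin p ⊎ Fin q → Fin 3
    cell i = [ const (s i) , const (t i) ]′

    colour : Fin (r * (p + q)) → Fin 3
    colour v = let i , j = remQuot (p + q) v in cell i (splitAt p j)

    sum-blocks : (f : Fin r → Fin 3 → ℕ) → sum (λ v → f (part v) (colour v)) ≡
                 p * sum (λ i → f i (s i)) + q * sum (λ i → f i (t i))
    sum-blocks f = begin
      sum (λ v → f (part v) (colour v))
        ≡⟨ sum-remQuot r (λ (i , j) → f i (cell i (splitAt p j))) ⟩
      sum (λ i → sum (λ j → f i (cell i (splitAt p j))))
        ≡⟨ sum-cong-≗ (λ i → sum-splitAt p (f i ∘ cell i)) ⟩
      sum (λ i → sum {p} (const (f i (s i))) + sum {q} (const (f i (t i))))
        ≡⟨ sum-cong-≗ (λ i → cong₂ _+_ (sum-const p (f i (s i))) (sum-const q (f i (t i)))) ⟩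
      sum (λ i → p * f i (s i) + q * f i (t i))
        ≡⟨ ∑-distrib-+ (λ i → p * f i (s i)) (λ i → q * f i (t i)) ⟩
      sum (λ i → p * f i (s i)) + sum (λ i → q * f i (t i))
        ≡⟨ cong₂ _+_ (sum-*ˡ p (λ i → f i (s i))) (sum-*ˡ q (λ i → f i (t i))) ⟩
      p * sum (λ i → f i (s i)) + q * sum (λ i → f i (t i)) ∎
      where open ≡-Reasoning

    balanced : Balanced (p + q) part
    balanced i = begin
      ∣ tabulate (λ v → does (part v ≟ i)) ∣        ≡⟨ ∣tabulate∣≡sum (λ v → does (part v ≟ i)) ⟩
      sum (λ v → 𝟙 (does (part v ≟ i)))             ≡⟨ sum-blocks (λ j _ → 𝟙 (does (j ≟ i))) ⟩
      p * sum (λ j → 𝟙 (does (j ≟ i))) + q * sum (λ j → 𝟙 (does (j ≟ i)))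
        ≡⟨ cong (λ x → p * x + q * x) (sum-𝟙≟ʳ i) ⟩
      p * 1 + q * 1                                 ≡⟨ cong₂ _+_ (*-identityʳ p) (*-identityʳ q) ⟩
      p + q                                         ∎
      where open ≡-Reasoning

    degree≡ : ∀ v → degree (joinGraph part colour) v ≡
              p * blocks-s (part v) (colour v) + q * blocks-t (part v) (colour v)
    degree≡ v = trans (degree≡sum (joinGraph part colour) v) (sum-blocks (apart (part v) (colour v)))

    attains : ∀ {d} → (∀ i c → c ≡ s i ⊎ c ≡ t i → d ≤ p * blocks-s i c + q * blocks-t i c) →
              Attains (r * (p + q)) (p + q) r d
    attains d≤ = part , balanced , colour , λ v →
      ≤-trans (d≤ (part v) (colour v) (colour-s⊎t v)) (≤-reflexive (sym (degree≡ v)))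
      where
      colour-s⊎t : ∀ v → colour v ≡ s (part v) ⊎ colour v ≡ t (part v)
      colour-s⊎t v with splitAt p (proj₂ (remQuot {r} (p + q) v))
      ... | inj₁ _ = inj₁ refl
      ... | inj₂ _ = inj₂ refl

  module _ (κ a b : ℕ) where

    -- With `q = p * κ + e`, a degree is linear in `p` and `e`, with these two block counts as
    -- coefficients. Bounding them by `a` and `b` is a finite check that serves all `n` at once.
    Enough : Fin r → Fin 3 → Set
    Enough i c = a ≤ blocks-s i c + κ * blocks-t i c × b ≤ blocks-t i c

    enough? : Dec (∀ i → Enough i (s i) × Enough i (t i))
    enough? = all? λ i → enough-at? i (s i) ×-dec enough-at? i (t i)
      where
      enough-at? : ∀ i c → Dec (Enough i c)
      enough-at? i c = (a ≤? _) ×-dec (b ≤? _)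

    enough⇒attains : (∀ i → Enough i (s i) × Enough i (t i)) → ∀ p e →
      let n = p + (p * κ + e) in Attains (r * n) n r (p * a + e * b)
    enough⇒attains enough p e = attains p (p * κ + e) λ where
        i _ (inj₁ refl) → weigh i (s i) (proj₁ (enough i))
        i _ (inj₂ refl) → weigh i (t i) (proj₂ (enough i))
      where
      regroup : ∀ p κ e x y → p * (x + κ * y) + e * y ≡ p * x + (p * κ + e) * y
      regroup = solve-∀
      weigh : ∀ i c → Enough i c → p * a + e * b ≤ p * blocks-s i c + (p * κ + e) * blocks-t i c
      weigh i c (a≤ , b≤) =
        ≤-trans (+-mono-≤ (*-monoʳ-≤ p a≤) (*-monoʳ-≤ e b≤))
                (≤-reflexive (regroup p κ e (blocks-s i c) (blocks-t i c)))

-- Division with remainder and the two cases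

<-from-slack : ∀ {x y z c} → x + c ≡ y + z → z < c → x < y
<-from-slack {x} {y} {z} {c} eq z<c =
  +-cancelʳ-< c x y (subst (_< y + c) (sym eq) (+-monoʳ-< y z<c))

n≡p+[p*κ+e] : ∀ κ n → n ≡ n / suc κ + (n / suc κ * κ + n % suc κ)
n≡p+[p*κ+e] κ n = trans (m≡m%n+[m/n]*n n (suc κ)) (regroup (n % suc κ) (n / suc κ) κ)
  where
  regroup : ∀ e p κ → e + p * suc κ ≡ p + (p * κ + e)
  regroup = solve-∀

f≡δ-10 : ∀ n → n ≥ 1 → ∃[ m ] (Is-f n 10 4 m × Is-δ n 10 3 m)
f≡δ-10 n n≥1 =
  f≡δ (combine {10} zero (fromℕ< n≥1))
      -- Both colours of a mixed part give 25, as 4 + 3 · 7 and 7 + 3 · 6; colours 1 and 2 see only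
      -- 6 blocks of size `q`. For `e < 4` the bound `p * 25 + e * 6` is exactly ⌊50n/8⌋.
      (subst (λ n → Attains (10 * n) n 10 (p * 25 + e * 6)) (sym (n≡p+[p*κ+e] 3 n))
        (enough⇒attains 3 25 6 (from-yes (enough? 3 25 6)) p e))
      (<-from-slack (trans (cong (λ n → 5 * (10 * n) + 8) (n≡p+[p*κ+e] 3 n)) (slack p e))
                    (*-monoʳ-< 2 (m%n<n n 4)))
  where
  p = n / 4
  e = n % 4
  open Mixed (lookup (0F ∷ 0F ∷ 1F ∷ 1F ∷ 0F ∷ 0F ∷ 2F ∷ 2F ∷ 0F ∷ 0F ∷ []))
             (lookup (0F ∷ 0F ∷ 1F ∷ 1F ∷ 1F ∷ 1F ∷ 2F ∷ 2F ∷ 2F ∷ 2F ∷ []))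
  slack : ∀ p e → 5 * (10 * (p + (p * 3 + e))) + 8 ≡ 8 * suc (p * 25 + e * 6) + 2 * e
  slack = solve-∀

f≡δ-13 : ∀ n → n ≥ 1 → ∃[ m ] (Is-f n 13 4 m × Is-δ n 13 3 m)
f≡δ-13 n n≥1 =
  f≡δ (combine {13} zero (fromℕ< n≥1))
      -- The minimum 65 = 9 + 7 · 8 occurs at colours 1 and 2 of the mixed parts. For `e < 8` the
      -- bound `p * 65 + e * 8` is exactly ⌊65n/8⌋.
      (subst (λ n → Attains (13 * n) n 13 (p * 65 + e * 8)) (sym (n≡p+[p*κ+e] 7 n))
        (enough⇒attains 7 65 8 (from-yes (enough? 7 65 8)) p e))
      (<-from-slack (trans (cong (λ n → 5 * (13 * n) + 8) (n≡p+[p*κ+e] 7 n)) (slack p e))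
                    (m%n<n n 8))
  where
  p = n / 8
  e = n % 8
  open Mixed
    (lookup (0F ∷ 0F ∷ 0F ∷ 1F ∷ 1F ∷ 1F ∷ 0F ∷ 0F ∷ 2F ∷ 2F ∷ 2F ∷ 0F ∷ 0F ∷ []))
    (lookup (0F ∷ 0F ∷ 0F ∷ 1F ∷ 1F ∷ 1F ∷ 1F ∷ 1F ∷ 2F ∷ 2F ∷ 2F ∷ 2F ∷ 2F ∷ []))
  slack : ∀ p e → 5 * (13 * (p + (p * 7 + e))) + 8 ≡ 8 * suc (p * 65 + e * 8) + e
  slack = solve-∀

proposition5p2 : ∀ (n : ℕ) → n ≥ 1 →
    (∃[ m ] (Is-f n 10 4 m × Is-δ n 10 3 m)) × (∃[ m ] (Is-f n 13 4 m × Is-δ n 13 3 m))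
proposition5p2 n n≥1 = f≡δ-10 n n≥1 , f≡δ-13 n n≥1
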